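{- For any rooted tree with $n$ nodes whose edges are labeled by letters from an alphabet of size $\sigma$ there are $O(n\sigma)$ minimal absent words, and this bound is tight (i.e., it is realized).
   Context: Let $T$ be a rooted tree with $n$ nodes whose edges are labeled by letters of an integer alphabet $\Sigma$ of cardinality $\sigma$ polynomial in $n$. Rooted trees are assumed to be deterministic, i.e., the edges from a node to its children are labeled by pairwise distinct letters. For a node $v$ of $T$, $\mathsf{str}(v)$ denotes the word obtained by reading the edge labels along the path from $v$ to the root. The language of $T$ is $L_T=\{\mathsf{str}(v)\mid v \text{ a node of } T\}$. A factor of a word is a contiguous subword. A word $aub$ with $a,b\in\Sigma$ and $u$ a (possibly empty) word over $\Sigma$ is a minimal absent word of $T$ if $aub$ is not a factor of any word in $L_T$, but $au$ is a factor of some word in $L_T$ and $ub$ is a factor of some (not necessarily distinct) word in $L_T$. -}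

module Defs where

open import Data.Nat using (ℕ; suc; _+_)
open import Data.Fin using (Fin)
open import Data.List using (List; []; _∷_; _++_; [_]; map; length)
open import Data.List.Membership.Propositional using (_∈_)
open import Data.List.Relation.Binary.Infix.Heterogeneous using (Infix)
open import Data.List.Relation.Unary.All using (All)
open import Data.List.Relation.Unary.Unique.Propositional using (Unique)
open import Data.Product using (_×_; _,_; proj₁; proj₂; ∃-syntax)
open import Function using (_∘_; _⇔_)
open import Relation.Binary.PropositionalEquality using (_≡_)
open import Relation.Nullary using (¬_)

Word : ℕ → Set
Word σ = List (Fin σ)

-- The pair (a , t) in the list is an edge labeled a to a child whose subtree
-- is t. The order of the list plays no role in what follows.
data Tree (σ : ℕ) : Set where
  node : List (Fin σ × Tree σ) → Tree σ

data Deterministic {σ : ℕ} : Tree σ → Set where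
  node : ∀ {ts} → Unique (map proj₁ ts) → All (Deterministic ∘ proj₂) ts →
         Deterministic (node ts)

mutual
  size : ∀ {σ} → Tree σ → ℕ
  size (node ts) = suc (sizes ts)

  sizes : ∀ {σ} → List (Fin σ × Tree σ) → ℕ
  sizes []             = 0
  sizes ((_ , t) ∷ ts) = size t + sizes ts

data Node {σ : ℕ} : Tree σ → Set where
  root  : ∀ {T} → Node T
  below : ∀ {ts a t} → (a , t) ∈ ts → Node t → Node (node ts)

-- Labels are read from the node up to the root, so the label of the edge
-- leaving the root comes last.
str : ∀ {σ} {T : Tree σ} → Node T → Word σ
str root                = []
str (below {a = a} _ v) = str v ++ [ a ]

Language : ∀ {σ} → Tree σ → Word σ → Set
Language T w = ∃[ v ] w ≡ str {T = T} v

FactorOf : ∀ {σ} → Tree σ → Word σ → Set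
FactorOf T w = ∃[ x ] Language T x × Infix _≡_ w x

MinimalAbsentWord : ∀ {σ} → Tree σ → Word σ → Set
MinimalAbsentWord T w = ∃[ a ] ∃[ u ] ∃[ b ]
  w ≡ a ∷ u ++ [ b ] ×
  ¬ FactorOf T (a ∷ u ++ [ b ]) ×
  FactorOf T (a ∷ u) ×
  FactorOf T (u ++ [ b ])

-- Exactly k words satisfy P: they are enumerated without repetition by a list
-- of length k.
HasCardinality : ∀ {σ} → (Word σ → Set) → ℕ → Set
HasCardinality P k = ∃[ ws ] Unique ws × (∀ w → w ∈ ws ⇔ P w) × length ws ≡ k

{-# OPTIONS --safe #-}
-- Every factor is a prefix of some word of the language. If aub is a minimal
-- absent word, then ub is a prefix of some x and u, but not ub, is a prefix of
-- some y in the language, so ub is the shortest prefix of x that is not a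
-- prefix of y. By the ultrametric inequality for longest common prefixes, n
-- words have at most 3n such escaping prefixes: to account for a new word it
-- suffices to compare it with one nearest word among the previous ones.
-- The letter a then contributes the factor σ.
--
-- For tightness, hang ℓ ≈ σ/2 leaves with nonzero labels a below a path
-- spelling 0^m 1. Then a 0^i 1 is minimal absent for all i < m.
module Submission where

open import Defs
open import Data.Fin as Fin using (Fin; zero; suc; toℕ; inject≤; remQuot; combine)
open import Data.Fin.Properties as Fin
  using (suc-injective; inject≤-injective; toℕ<n; toℕ-injective; combine-remQuot; injective⇒≤)
open import Data.List
  using (List; []; _∷_; [_]; _++_; map; length; filter; deduplicate; replicate; tabulate; allFin;
         cartesianProductWith; initLast; _∷ʳ′_)
open import Data.List.Extrema using (argmax; argmax-sel; f[⊥]≤f[argmax]; f[xs]≤f[argmax])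
open import Data.List.Membership.Propositional using (_∈_; find; lose)
open import Data.List.Membership.Propositional.Properties
open import Data.List.Membership.Setoid.Properties using (index-injective)
open import Data.List.Properties
open import Data.List.Relation.Binary.Infix.Heterogeneous using (Infix; here; there)
open import Data.List.Relation.Binary.Infix.Heterogeneous.Properties as Infix
  using (infix?; fromPointwise)
open import Data.List.Relation.Binary.Pointwise using (≡⇒Pointwise-≡)
open import Data.List.Relation.Binary.Prefix.Heterogeneous using (Prefix; []; _∷_; _++ᵖ_)
open import Data.List.Relation.Binary.Prefix.Heterogeneous.Properties using (replicate⁺)
open import Data.List.Relation.Unary.All using ([]; _∷_)
import Data.List.Relation.Unary.All as All
import Data.List.Relation.Unary.All.Properties as All
open import Data.List.Relation.Unary.AllPairs using ([]; _∷_)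
open import Data.List.Relation.Unary.Any using (here; there; any?; index)
open import Data.List.Relation.Unary.Unique.Propositional using (Unique)
open import Data.List.Relation.Unary.Unique.Propositional.Properties using (tabulate⁺)
import Data.List.Relation.Unary.Unique.DecPropositional.Properties as DecUnique
open import Data.Nat using (ℕ; zero; suc; _+_; _*_; _≤_; _<_; z≤n; s≤s; _≤?_; _∸_; pred; ⌊_/2⌋; ⌈_/2⌉)
open import Data.Nat.Properties hiding (suc-injective)
open import Data.Nat.Solver using (module +-*-Solver)
open import Data.Product using (_×_; ∃-syntax; _,_; proj₁; proj₂)
open import Data.Sum as Sum using (_⊎_; inj₁; inj₂)
open import Function using (_∘_; mk⇔; Equivalence)
open import Function.Definitions using (Injective)
open import Relation.Binary.PropositionalEquality hiding ([_])
open import Relation.Nullary using (¬_; yes; no; contradiction; ¬?; _×-dec_)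
open import Relation.Nullary.Decidable using (map′)
open import Relation.Unary using (Decidable)

private
  variable
    σ : ℕ
    T : Tree σ

-- Escaping prefixes

-- The length of the longest common prefix; a larger value means closer words.
common : Word σ → Word σ → ℕ
common [] _ = 0
common (_ ∷ _) [] = 0
common (a ∷ x) (b ∷ y) with a Fin.≟ b
... | yes _ = suc (common x y)
... | no _ = 0

-- The shortest prefix of x that is not a prefix of y, and x itself when x is
-- a prefix of y.
escape : Word σ → Word σ → Word σ
escape [] _ = []
escape (a ∷ _) [] = [ a ]
escape (a ∷ x) (b ∷ y) with a Fin.≟ b
... | yes _ = a ∷ escape x y
... | no _ = [ a ]

-- The link to minimal absent words: u is then the longest common prefix of x and y, and b is the
-- letter at which x leaves y.
escape-prefix : ∀ (u : Word σ) {b x y} → Prefix _≡_ (u ++ [ b ]) x →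
                Prefix _≡_ u y → ¬ Prefix _≡_ (u ++ [ b ]) y → escape x y ≡ u ++ [ b ]
escape-prefix [] {y = []} (refl ∷ _) [] _ = refl
escape-prefix [] {b} {y = c ∷ _} (refl ∷ _) [] b⋢y with b Fin.≟ c
... | yes refl = contradiction (refl ∷ []) b⋢y
... | no _ = refl
escape-prefix (a ∷ u) (refl ∷ ub⊑x) (refl ∷ u⊑y) aub⋢y with a Fin.≟ a
... | yes _ = cong (a ∷_) (escape-prefix u ub⊑x u⊑y (aub⋢y ∘ (refl ∷_)))
... | no a≢a = contradiction refl a≢a

-- The first `common x y` letters of x are shared by y and, by hypothesis, by z, so y and z share
-- them too. This lets a word z nearest to x be used from the side of y.
common-ultrametric : ∀ (x y z : Word σ) → common x y ≤ common x z → common y x ≤ common y z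
common-ultrametric _ [] _ _ = z≤n
common-ultrametric [] (_ ∷ _) _ _ = z≤n
common-ultrametric (a ∷ x) (b ∷ y) z le with b Fin.≟ a
... | no _ = z≤n
common-ultrametric (a ∷ x) (a ∷ y) [] le | yes refl with a Fin.≟ a
... | no a≢a = contradiction refl a≢a
common-ultrametric (a ∷ x) (a ∷ y) (c ∷ z) le | yes refl with a Fin.≟ a | a Fin.≟ c
common-ultrametric (a ∷ x) (a ∷ y) (c ∷ z) (s≤s le) | yes refl | yes _ | yes _ =
  s≤s (common-ultrametric x y z le)
... | no a≢a | _ = contradiction refl a≢a

-- If z agrees with x exactly as long as y does, both escapes of x end at the same position. If z
-- agrees longer, it also contains the letter at which x leaves y, so z leaves y by the same prefix.
escape-ultrametric : ∀ (x y z : Word σ) → common x y ≤ common x z →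
                     escape x y ≡ escape x z ⊎ escape x y ≡ escape z y
escape-ultrametric [] _ _ _ = inj₁ refl
escape-ultrametric (a ∷ x) [] [] _ = inj₁ refl
escape-ultrametric (a ∷ x) [] (c ∷ z) _ with a Fin.≟ c
... | yes refl = inj₂ refl
... | no _ = inj₁ refl
escape-ultrametric (a ∷ x) (b ∷ y) [] le with a Fin.≟ b
... | no _ = inj₁ refl
escape-ultrametric (a ∷ x) (b ∷ y) (c ∷ z) le with a Fin.≟ b | a Fin.≟ c
escape-ultrametric (a ∷ x) (a ∷ y) (a ∷ z) (s≤s le) | yes refl | yes refl with a Fin.≟ a
... | yes _ = Sum.map (cong (a ∷_)) (cong (a ∷_)) (escape-ultrametric x y z le)
... | no a≢a = contradiction refl a≢a
escape-ultrametric (a ∷ x) (b ∷ y) (a ∷ z) le | no a≢b | yes refl with a Fin.≟ b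
... | yes a≡b = contradiction a≡b a≢b
... | no _ = inj₂ refl
escape-ultrametric (a ∷ x) (b ∷ y) (c ∷ z) le | no _ | no _ = inj₁ refl

-- Nearest words and a linear list of all escapes

nearest : Word σ → List (Word σ) → Word σ
-- A default: with nothing to compare with, `escape x x` is x, which `escapes` lists anyway.
nearest x [] = x
nearest x (y ∷ ys) = argmax ≤-totalOrder (common x) y ys

nearest-∈ : ∀ (x : Word σ) {y ys} → y ∈ ys → nearest x ys ∈ ys
nearest-∈ x {ys = y ∷ ys} _ with argmax-sel ≤-totalOrder (common x) y ys
... | inj₁ eq = here eq
... | inj₂ z∈ys = there z∈ys

nearest-max : ∀ (x : Word σ) {y ys} → y ∈ ys → common x y ≤ common x (nearest x ys)
nearest-max x {ys = y ∷ ys} (here refl) = f[⊥]≤f[argmax] ≤-totalOrder {f = common x} y ys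
nearest-max x {ys = y ∷ ys} (there y∈ys) =
  All.lookup (f[xs]≤f[argmax] ≤-totalOrder {f = common x} y ys) y∈ys

-- Each word adds three entries: itself, as its escape from itself, and the escapes in both
-- directions between it and its nearest word in the rest of the list.
escapes : List (Word σ) → List (Word σ)
escapes [] = []
escapes (x ∷ ys) = x ∷ escape x (nearest x ys) ∷ escape (nearest x ys) x ∷ escapes ys

escape-refl : ∀ (x : Word σ) → escape x x ≡ x
escape-refl [] = refl
escape-refl (a ∷ x) with a Fin.≟ a
... | yes _ = cong (a ∷_) (escape-refl x)
... | no a≢a = contradiction refl a≢a

-- Induction on the list. Let z be nearest to the head x. For y in the tail, the ultrametric lemma
-- turns an escape between x and y, in either direction, into one between x and z, which is listed,
-- or into one between y and z, which is covered by induction.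
escape∈escapes : ∀ {xs : List (Word σ)} {x y} → x ∈ xs → y ∈ xs → escape x y ∈ escapes xs
escape∈escapes {x = x} (here refl) (here refl) = here (escape-refl x)
escape∈escapes {xs = x ∷ ys} {y = y} (here refl) (there y∈ys)
  with escape-ultrametric x y (nearest x ys) (nearest-max x y∈ys)
... | inj₁ eq = there (here eq)
... | inj₂ eq = there (there (there
        (subst (_∈ escapes ys) (sym eq) (escape∈escapes (nearest-∈ x y∈ys) y∈ys))))
escape∈escapes {xs = x ∷ ys} {x = y} (there y∈ys) (here refl)
  with escape-ultrametric y x (nearest x ys)
         (common-ultrametric x y (nearest x ys) (nearest-max x y∈ys))
... | inj₁ eq = there (there (there
        (subst (_∈ escapes ys) (sym eq) (escape∈escapes y∈ys (nearest-∈ x y∈ys)))))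
... | inj₂ eq = there (there (here eq))
escape∈escapes (there x∈ys) (there y∈ys) = there (there (there (escape∈escapes x∈ys y∈ys)))

length-escapes : ∀ (xs : List (Word σ)) → length (escapes xs) ≡ length xs * 3
length-escapes [] = refl
length-escapes (_ ∷ xs) = cong (3 +_) (length-escapes xs)

-- The language of a tree

mutual
  -- One entry per node, repetitions included, so that the length is exactly `size T`.
  strs : Tree σ → List (Word σ)
  strs (node ts) = [] ∷ strsBelow ts

  strsBelow : List (Fin σ × Tree σ) → List (Word σ)
  strsBelow [] = []
  strsBelow ((a , t) ∷ ts) = map (_++ [ a ]) (strs t) ++ strsBelow ts

mutual
  length-strs : ∀ (T : Tree σ) → length (strs T) ≡ size T
  length-strs (node ts) = cong suc (length-strsBelow ts)

  length-strsBelow : ∀ (ts : List (Fin σ × Tree σ)) → length (strsBelow ts) ≡ sizes ts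
  length-strsBelow [] = refl
  length-strsBelow ((a , t) ∷ ts) = trans (length-++ (map (_++ [ a ]) (strs t)))
    (cong₂ _+_ (trans (length-map _ (strs t)) (length-strs t)) (length-strsBelow ts))

str∈strs : ∀ (v : Node T) → str v ∈ strs T
str∈strs {T = node _} root = here refl
str∈strs (below e v) = there (inBelow e (str∈strs v))
  where
  inBelow : ∀ {ts : List (Fin σ × Tree σ)} {a t w} →
            (a , t) ∈ ts → w ∈ strs t → w ++ [ a ] ∈ strsBelow ts
  inBelow (here refl) w∈ = ∈-++⁺ˡ (∈-map⁺ _ w∈)
  inBelow {ts = (a , t) ∷ _} (there e) w∈ =
    ∈-++⁺ʳ (map (_++ [ a ]) (strs t)) (inBelow e w∈)

mutual
  ∈strs⇒Language : ∀ (T : Tree σ) {w} → w ∈ strs T → Language T w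
  ∈strs⇒Language (node ts) (here refl) = root , refl
  ∈strs⇒Language (node ts) (there w∈) with ∈strsBelow⇒child ts w∈
  ... | _ , _ , e , v , refl = below e v , refl

  ∈strsBelow⇒child : ∀ (ts : List (Fin σ × Tree σ)) {w} → w ∈ strsBelow ts →
    ∃[ a ] ∃[ t ] (a , t) ∈ ts × ∃[ v ] w ≡ str {T = t} v ++ [ a ]
  ∈strsBelow⇒child ((a , t) ∷ ts) w∈ with ∈-++⁻ (map (_++ [ a ]) (strs t)) w∈
  ... | inj₂ w∈ts with ∈strsBelow⇒child ts w∈ts
  ...   | b , s , e , rest = b , s , there e , rest
  ∈strsBelow⇒child ((a , t) ∷ ts) w∈ | inj₁ w∈t with ∈-map⁻ (_++ [ a ]) w∈t
  ... | x , x∈t , refl with ∈strs⇒Language t x∈t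
  ...   | v , refl = a , t , here refl , v , refl

factorOf? : ∀ (T : Tree σ) → Decidable (FactorOf T)
factorOf? T w = map′
  (λ p → let x , x∈ , w⊑x = find p in x , ∈strs⇒Language T x∈ , w⊑x)
  (λ { (_ , (v , refl) , w⊑x) → lose (str∈strs v) w⊑x })
  (any? (infix? Fin._≟_ w) (strs T))

-- `HasCardinality` demands an exact enumeration; decidability allows it to be filtered out of a
-- list of candidates.
minimalAbsentWord? : ∀ (T : Tree σ) → Decidable (MinimalAbsentWord T)
minimalAbsentWord? T [] = no λ ()
minimalAbsentWord? T (a ∷ w) with initLast w
... | [] = no λ { (_ , [] , _ , () , _) ; (_ , _ ∷ _ , _ , () , _) }
... | u ∷ʳ′ b = map′
  (λ (p , q , r) → a , u , b , refl , p , q , r)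
  (λ (a′ , u′ , b′ , eq , pqr) → transport eq pqr)
  (¬? (factorOf? T (a ∷ u ++ [ b ])) ×-dec factorOf? T (a ∷ u) ×-dec factorOf? T (u ++ [ b ]))
  where
  Q : Fin _ → Word _ → Fin _ → Set
  Q a u b = ¬ FactorOf T (a ∷ u ++ [ b ]) × FactorOf T (a ∷ u) × FactorOf T (u ++ [ b ])
  -- A word splits as aub in at most one way, so testing the split found by `initLast` suffices.
  transport : ∀ {a′ u′ b′} → a ∷ u ++ [ b ] ≡ a′ ∷ u′ ++ [ b′ ] → Q a′ u′ b′ → Q a u b
  transport {u′ = u′} eq pqr with ∷-injective eq
  ... | refl , eq′ with ∷ʳ-injective u u′ eq′
  ...   | refl , refl = pqr

-- Words are read upwards, so dropping the first letter passes from a node to its parent.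
Language-tail : ∀ {c x} → Language T (c ∷ x) → Language T x
Language-tail (v , eq) = go v (sym eq)
  where
  go : ∀ {T : Tree σ} {c x} (v : Node T) → str v ≡ c ∷ x → Language T x
  go (below {a = a} e v) eq with str v in strv
  go (below e v) refl | [] = root , refl
  go (below {a = a} e v) refl | _ ∷ _ with go v strv
  ... | v′ , refl = below e v′ , refl

-- The language is closed under suffixes: drop the letters in front of the occurrence.
factor⇒prefix : ∀ {w} → FactorOf T w → ∃[ x ] Language T x × Prefix _≡_ w x
factor⇒prefix (_ , x∈L , w⊑x) = go x∈L w⊑x
  where
  go : ∀ {w x} → Language T x → Infix _≡_ w x → ∃[ y ] Language T y × Prefix _≡_ w y
  go x∈L (here w⊑x) = _ , x∈L , w⊑x
  go x∈L (there w⊑x) = go (Language-tail x∈L) w⊑x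

-- The upper bound

length-cartesianProductWith : ∀ {A B C : Set} (f : A → B → C) xs ys →
  length (cartesianProductWith f xs ys) ≡ length xs * length ys
length-cartesianProductWith f [] ys = refl
length-cartesianProductWith f (x ∷ xs) ys = trans (length-++ (map (f x) ys))
  (cong₂ _+_ (length-map (f x) ys) (length-cartesianProductWith f xs ys))

hasCardinality≤ : ∀ {P : Word σ → Set} → Decidable P → ∀ ws → (∀ w → P w → w ∈ ws) →
                  ∃[ k ] HasCardinality P k × k ≤ length ws
hasCardinality≤ {P = P} P? ws complete =
  _ , (distinct , DecUnique.deduplicate-! _≟ʷ_ _ , (λ w → mk⇔
    (λ w∈ → proj₂ (∈-filter⁻ P? {xs = ws} (∈-deduplicate⁻ _≟ʷ_ (filter P? ws) w∈)))
    (λ Pw → ∈-deduplicate⁺ _≟ʷ_ (∈-filter⁺ P? (complete w Pw) Pw))) , refl) ,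
  ≤-trans (length-deduplicate _≟ʷ_ (filter P? ws)) (length-filter P? ws)
  where
  _≟ʷ_ = ≡-dec Fin._≟_
  distinct = deduplicate _≟ʷ_ (filter P? ws)

extendedEscapes : Tree σ → List (Word σ)
extendedEscapes {σ} T = cartesianProductWith _∷_ (allFin σ) (escapes (strs T))

-- Let au be a prefix of ay and ub a prefix of x, with ay and x in the language. Then y is in the
-- language as well, and ub is `escape x y`: were ub a prefix of y, aub would be a factor.
maw∈extendedEscapes : ∀ w → MinimalAbsentWord T w → w ∈ extendedEscapes T
maw∈extendedEscapes w (a , u , b , refl , absent , au , ub)
  with factor⇒prefix au | factor⇒prefix ub
... | a ∷ y , ay∈L , refl ∷ u⊑y | x , (vx , refl) , ub⊑x with Language-tail ay∈L
...   | vy , refl = ∈-cartesianProductWith⁺ _∷_ (∈-allFin a)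
  (subst (_∈ escapes _)
    (escape-prefix u ub⊑x u⊑y λ ub⊑y → absent (_ , ay∈L , here (refl ∷ ub⊑y)))
    (escape∈escapes (str∈strs vx) (str∈strs vy)))

length-extendedEscapes : ∀ (T : Tree σ) → length (extendedEscapes T) ≡ 3 * (size T * σ)
length-extendedEscapes {σ} T = begin
  length (extendedEscapes T)                  ≡⟨ length-cartesianProductWith _∷_ (allFin σ) _ ⟩
  length (allFin σ) * length (escapes (strs T))
    ≡⟨ cong₂ _*_ (length-tabulate {n = σ} (λ i → i)) (length-escapes (strs T)) ⟩
  σ * (length (strs T) * 3)                   ≡⟨ cong (λ n → σ * (n * 3)) (length-strs T) ⟩
  σ * (size T * 3)
    ≡⟨ solve 2 (λ s n → s :* (n :* con 3) := con 3 :* (n :* s)) refl σ (size T) ⟩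
  3 * (size T * σ)                            ∎
  where
  open ≡-Reasoning
  open +-*-Solver

mawCount : ∀ (T : Tree σ) →
           ∃[ k ] HasCardinality (MinimalAbsentWord T) k × k ≤ 3 * (size T * σ)
mawCount T with hasCardinality≤ (minimalAbsentWord? T) (extendedEscapes T) maw∈extendedEscapes
... | k , card , k≤ = k , card , subst (k ≤_) (length-extendedEscapes T) k≤

-- The lower bound

-- Pigeonhole: distinct words occupy distinct positions in the enumeration.
injection⇒≤ : ∀ {P : Word σ → Set} {k l} → HasCardinality P k → (f : Fin l → Word σ) →
              Injective _≡_ _≡_ f → (∀ i → P (f i)) → l ≤ k
injection⇒≤ {σ = σ} {P = P} (ws , _ , ∈⇔P , refl) f f-inj Pf =
  injective⇒≤ {f = λ i → index (f∈ i)}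
    (λ {i} {j} eq → f-inj (index-injective (setoid (Word σ)) (f∈ i) (f∈ j) eq))
  where
  f∈ : ∀ i → f i ∈ ws
  f∈ i = Equivalence.from (∈⇔P (f i)) (Pf i)

-- Powers of a letter followed by another letter

module _ {A : Set} where

  replicate-∷ʳ : ∀ k (a : A) → replicate k a ++ [ a ] ≡ replicate (suc k) a
  replicate-∷ʳ zero a = refl
  replicate-∷ʳ (suc k) a = cong (a ∷_) (replicate-∷ʳ k a)

  infix-refl : ∀ (w : List A) → Infix _≡_ w w
  infix-refl w = fromPointwise (≡⇒Pointwise-≡ refl)

  replicate-infix : ∀ {i m} (a : A) w → i ≤ m →
                    Infix _≡_ (replicate i a ++ w) (replicate m a ++ w)
  replicate-infix {m = zero} a w z≤n = infix-refl w
  replicate-infix {i} {suc m} a w i≤1+m with m≤n⇒m<n∨m≡n i≤1+m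
  ... | inj₁ (s≤s i≤m) = there (replicate-infix a w i≤m)
  ... | inj₂ refl = infix-refl _

  -- The words differ at position i, where one has b and the other still has a.
  replicate-⋢ : ∀ {i m} {a b : A} → b ≢ a → i < m → ∀ w →
                ¬ Prefix _≡_ (replicate i a ++ [ b ]) (replicate m a ++ w)
  replicate-⋢ {zero} {suc m} b≢a _ w (b≡a ∷ _) = b≢a b≡a
  replicate-⋢ {suc i} {suc m} b≢a (s≤s i<m) w (_ ∷ p) = replicate-⋢ b≢a i<m w p

  -- Since a is not c, it can only match the final d, which leaves no room for b. The case a = d is
  -- included.
  ¬infix-replicate : ∀ j {a b c d : A} {u} → a ≢ c →
                     ¬ Infix _≡_ (a ∷ u ++ [ b ]) (replicate j c ++ [ d ])
  ¬infix-replicate zero {u = []} a≢c (here (_ ∷ ()))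
  ¬infix-replicate zero {u = _ ∷ _} a≢c (here (_ ∷ ()))
  ¬infix-replicate zero a≢c (there (here ()))
  ¬infix-replicate (suc j) a≢c (here (a≡c ∷ _)) = a≢c a≡c
  ¬infix-replicate (suc j) a≢c (there p) = ¬infix-replicate j a≢c p

  replicate-injective : ∀ i j {a b : A} → b ≢ a →
                        replicate i a ++ [ b ] ≡ replicate j a ++ [ b ] → i ≡ j
  replicate-injective zero zero b≢a eq = refl
  replicate-injective zero (suc j) b≢a eq = contradiction (∷-injectiveˡ eq) b≢a
  replicate-injective (suc i) zero b≢a eq = contradiction (sym (∷-injectiveˡ eq)) b≢a
  replicate-injective (suc i) (suc j) b≢a eq =
    cong suc (replicate-injective i j b≢a (∷-injectiveʳ eq))

-- Paths, stars and brooms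

chain : ℕ → Fin σ → Tree σ → Tree σ
chain zero a t = t
chain (suc k) a t = node [ (a , chain k a t) ]

chain-deterministic : ∀ k {a : Fin σ} {t} → Deterministic t → Deterministic (chain k a t)
chain-deterministic zero d = d
chain-deterministic (suc k) d = node ([] ∷ []) (chain-deterministic k d ∷ [])

size-chain : ∀ k {a : Fin σ} {t} → size (chain k a t) ≡ k + size t
size-chain zero = refl
size-chain (suc k) = cong suc (trans (+-identityʳ _) (size-chain k))

Language-chain⁺ : ∀ k {a : Fin σ} {t x} → Language t x → Language (chain k a t) (x ++ replicate k a)
Language-chain⁺ zero {x = x} (v , refl) = v , ++-identityʳ x
Language-chain⁺ (suc k) {a} {x = x} x∈L with Language-chain⁺ k {a} x∈L
... | v , eq = below (here refl) v , (begin
  x ++ replicate (suc k) a        ≡⟨ cong (x ++_) (replicate-∷ʳ k a) ⟨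
  x ++ replicate k a ++ [ a ]     ≡⟨ ++-assoc x _ _ ⟨
  (x ++ replicate k a) ++ [ a ]   ≡⟨ cong (_++ [ a ]) eq ⟩
  str v ++ [ a ]                  ∎)
  where open ≡-Reasoning

Language-chain⁻ : ∀ k {a : Fin σ} {t x} → Language (chain k a t) x →
  (∃[ i ] i ≤ k × x ≡ replicate i a) ⊎ (∃[ y ] Language t y × x ≡ y ++ replicate k a)
Language-chain⁻ zero {x = x} x∈L = inj₂ (x , x∈L , sym (++-identityʳ x))
Language-chain⁻ (suc k) (root , refl) = inj₁ (0 , z≤n , refl)
Language-chain⁻ (suc k) {a} (below (here refl) v , refl) with Language-chain⁻ k {a} (v , refl)
... | inj₁ (i , i≤k , eq) =
  inj₁ (suc i , s≤s i≤k , trans (cong (_++ [ a ]) eq) (replicate-∷ʳ i a))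
... | inj₂ (y , y∈L , eq) = inj₂ (y , y∈L ,
  trans (cong (_++ [ a ]) eq) (trans (++-assoc y _ _) (cong (y ++_) (replicate-∷ʳ k a))))

-- The path has k + 1 edges, so a^(k+1) is in the language and a^(k+2) is longer than all of its
-- words.
path-maw : ∀ k (a : Fin σ) →
           MinimalAbsentWord (chain (suc k) a (node [])) (a ∷ replicate k a ++ [ a ])
path-maw {σ} k a = a , replicate k a , a , refl , absent , present ,
  subst (FactorOf (chain (suc k) a (node []))) (sym (replicate-∷ʳ k a)) present
  where
  present : FactorOf (chain (suc k) a (node [])) (replicate (suc k) a)
  present = _ , Language-chain⁺ (suc k) (root , refl) , infix-refl _

  short : ∀ {x} → Language (chain (suc k) a (node [])) x → length x ≤ suc k
  short x∈L with Language-chain⁻ (suc k) x∈L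
  ... | inj₁ (i , i≤ , refl) = subst (_≤ suc k) (sym (length-replicate i)) i≤
  ... | inj₂ (_ , (root , refl) , refl) = ≤-reflexive (length-replicate (suc k))
  ... | inj₂ (_ , (below () _ , _) , _)

  absent : ¬ FactorOf (chain (suc k) a (node [])) (a ∷ replicate k a ++ [ a ])
  absent (x , x∈L , w⊑x) = 1+n≰n (begin
    suc (suc k)                           ≡⟨ length-replicate (suc (suc k)) ⟨
    length (replicate (suc (suc k)) a)    ≡⟨ cong (suc ∘ length) (replicate-∷ʳ k a) ⟨
    length (a ∷ replicate k a ++ [ a ])   ≤⟨ Infix.length-mono w⊑x ⟩
    length x                              ≤⟨ short x∈L ⟩
    suc k                                 ∎)
    where open ≤-Reasoning

star : List (Fin σ) → Tree σ
star as = node (map (_, node []) as)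

star-deterministic : ∀ {as : List (Fin σ)} → Unique as → Deterministic (star as)
star-deterministic {as = as} unique = node
  (subst Unique (trans (sym (map-id as)) (map-∘ as)) unique)
  (All.map⁺ (All.universal (λ _ → node [] []) as))

size-star : ∀ (as : List (Fin σ)) → size (star as) ≡ suc (length as)
size-star as = cong suc (go as)
  where
  go : ∀ (as : List (Fin _)) → sizes (map (_, node []) as) ≡ length as
  go [] = refl
  go (_ ∷ as) = cong suc (go as)

Language-star⁺ : ∀ {as} {a : Fin σ} → a ∈ as → Language (star as) [ a ]
Language-star⁺ a∈as = below (∈-map⁺ (_, node []) a∈as) root , refl

Language-star⁻ : ∀ {as} {x : Word σ} → Language (star as) x → x ≡ [] ⊎ (∃[ a ] x ≡ [ a ])
Language-star⁻ (root , eq) = inj₁ eq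
Language-star⁻ (below e v , refl) with ∈-map⁻ (_, node []) e
Language-star⁻ (below e root , refl) | a , _ , refl = inj₂ (a , refl)
Language-star⁻ (below e (below () _) , refl) | a , _ , refl

-- The edge d sits at the root because words are read upwards: a leaf labeled a spells a c^m d.
broom : ℕ → Fin σ → Fin σ → List (Fin σ) → Tree σ
broom m c d as = chain 1 d (chain m c (star as))

Language-broom⁺ : ∀ m {c d : Fin σ} {a as} → a ∈ as →
                  Language (broom m c d as) (a ∷ replicate m c ++ [ d ])
Language-broom⁺ m a∈as = Language-chain⁺ 1 (Language-chain⁺ m (Language-star⁺ a∈as))

Language-broom⁻ : ∀ m {c d : Fin σ} {as x} → Language (broom m c d as) x →
  x ≡ [] ⊎ (∃[ i ] x ≡ replicate i c ++ [ d ]) ⊎ (∃[ a ] x ≡ a ∷ replicate m c ++ [ d ])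
Language-broom⁻ m x∈L with Language-chain⁻ 1 x∈L
... | inj₁ (zero , _ , refl) = inj₁ refl
... | inj₁ (suc zero , _ , refl) = inj₂ (inj₁ (0 , refl))
... | inj₁ (suc (suc _) , s≤s () , _)
... | inj₂ (_ , y∈L , refl) with Language-chain⁻ m y∈L
...   | inj₁ (i , _ , refl) = inj₂ (inj₁ (i , refl))
...   | inj₂ (_ , z∈L , refl) with Language-star⁻ z∈L
...     | inj₁ refl = inj₂ (inj₁ (m , refl))
...     | inj₂ (a , refl) = inj₂ (inj₂ (a , refl))

-- Both a c^i and c^i d occur in a c^m d. As a is not c, an occurrence of a c^i d must start at a
-- leaf, but there a run of m > i letters c precedes d.
broom-maw : ∀ {i m} {a c d : Fin σ} {as} → a ≢ c → d ≢ c → a ∈ as → i < m →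
            MinimalAbsentWord (broom m c d as) (a ∷ replicate i c ++ [ d ])
broom-maw {i = i} {m} {a} {c} {d} {as} a≢c d≢c a∈as i<m =
  a , replicate i c , d , refl , absent ,
  (_ , Language-broom⁺ m a∈as , here (refl ∷ (replicate⁺ (<⇒≤ i<m) refl ++ᵖ [ d ]))) ,
  (_ , Language-broom⁺ m a∈as , there (replicate-infix c [ d ] (<⇒≤ i<m)))
  where
  absent : ¬ FactorOf (broom m c d as) (a ∷ replicate i c ++ [ d ])
  absent (x , x∈L , w⊑x) with Language-broom⁻ m x∈L
  absent (x , x∈L , here ()) | inj₁ refl
  absent (x , x∈L , w⊑x) | inj₂ (inj₁ (j , refl)) = ¬infix-replicate j a≢c w⊑x
  absent (x , x∈L , here (_ ∷ p)) | inj₂ (inj₂ (_ , refl)) = replicate-⋢ d≢c i<m [ d ] p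
  absent (x , x∈L , there p) | inj₂ (inj₂ (_ , refl)) = ¬infix-replicate m a≢c p

-- Parameters of the extremal trees

LowerBound : ℕ → ℕ → Set
LowerBound n σ = ∃[ T ] Deterministic {σ} T × size T ≡ n ×
  -- 18 = 6 · 3 comes from n ≤ 6m and σ ≤ 3ℓ for the broom; for the path, nσ ≤ 16.
  ∃[ k ] HasCardinality (MinimalAbsentWord T) k × n * σ ≤ 18 * k

-- The upper bound argument supplies an exact count k, and l distinct minimal absent words force l ≤
-- k.
lowerBoundFrom : ∀ (T : Tree σ) {l} (f : Fin l → Word σ) → Deterministic T →
                 Injective _≡_ _≡_ f → (∀ i → MinimalAbsentWord T (f i)) →
                 size T * σ ≤ 18 * l → LowerBound (size T) σ
lowerBoundFrom T f det f-inj f-maw bound with mawCount T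
... | k , card , _ = T , det , refl , k , card ,
  ≤-trans bound (*-monoʳ-≤ 18 (injection⇒≤ card f f-inj f-maw))

-- For n ≤ 4 there may be no room for both ℓ ≥ 1 leaves and m ≥ 1, so one minimal
-- absent word of a path has to do.
path-lowerBound : ∀ n σ → 2 ≤ σ → σ ≤ n → n ≤ 4 → LowerBound n σ
path-lowerBound (suc zero) _ (s≤s (s≤s _)) (s≤s ()) _
path-lowerBound (suc (suc k)) σ@(suc _) 2≤σ σ≤n n≤4 =
  subst (λ n → LowerBound n σ) size≡
    (lowerBoundFrom (chain (suc k) zero (node [])) {1} (λ _ → _)
      (chain-deterministic (suc k) (node [] []))
      (λ { {zero} {zero} _ → refl }) (λ _ → path-maw k zero)
      (subst (λ n → n * σ ≤ 18) (sym size≡)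
        (≤-trans (*-mono-≤ n≤4 (≤-trans σ≤n n≤4)) (m≤m+n 16 2))))
  where
  size≡ : size (chain (suc k) (zero {pred σ}) (node [])) ≡ 2 + k
  size≡ = trans (size-chain (suc k)) (+-comm (suc k) 1)

-- Leaf labels come from the 1 + s nonzero letters. An index below ℓ * m encodes a leaf and an
-- exponent i < m, which gives ℓm distinct minimal absent words.
broom-lowerBound : ∀ ℓ m s → ℓ ≤ suc s → 2 + s ≤ 3 * ℓ → 2 + ℓ + m ≤ 6 * m →
                   LowerBound (2 + ℓ + m) (2 + s)
broom-lowerBound ℓ m s ℓ≤1+s σ≤3ℓ n≤6m =
  subst (λ n → LowerBound n (2 + s)) size≡
    (lowerBoundFrom broom′ maw
      (chain-deterministic 1 (chain-deterministic m (star-deterministic (tabulate⁺ letter-injective))))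
      maw-injective
      (λ p → broom-maw (λ ()) (λ ()) (∈-tabulate⁺ (leaf p)) (toℕ<n (height p)))
      bound)
  where
  letter : Fin ℓ → Fin (2 + s)
  -- The shift keeps labels different from `zero`; a leaf may still carry `suc zero`, the label of
  -- the root edge.
  letter j = suc (inject≤ j ℓ≤1+s)

  letter-injective : ∀ {i j} → letter i ≡ letter j → i ≡ j
  letter-injective eq = inject≤-injective ℓ≤1+s ℓ≤1+s _ _ (suc-injective eq)

  broom′ : Tree (2 + s)
  broom′ = broom m zero (suc zero) (tabulate letter)

  size≡ : size broom′ ≡ 2 + ℓ + m
  size≡ = begin
    size broom′
      ≡⟨ size-chain 1 {suc zero} {chain m zero (star (tabulate letter))} ⟩
    suc (size (chain m zero (star (tabulate letter))))
      ≡⟨ cong suc (size-chain m) ⟩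
    suc (m + size (star (tabulate letter)))
      ≡⟨ cong (λ l → suc (m + l)) (size-star (tabulate letter)) ⟩
    suc (m + suc (length (tabulate letter)))
      ≡⟨ cong (λ l → suc (m + suc l)) (length-tabulate letter) ⟩
    suc (m + suc ℓ)                     ≡⟨ cong suc (+-comm m (suc ℓ)) ⟩
    2 + ℓ + m                           ∎
    where open ≡-Reasoning

  leaf : Fin (ℓ * m) → Fin ℓ
  leaf p = proj₁ (remQuot m p)

  height : Fin (ℓ * m) → Fin m
  height p = proj₂ (remQuot {ℓ} m p)

  maw : Fin (ℓ * m) → Word (2 + s)
  maw p = letter (leaf p) ∷ replicate (toℕ (height p)) zero ++ [ suc zero ]

  maw-injective : Injective _≡_ _≡_ maw
  maw-injective {p} {q} eq = begin
    p                               ≡⟨ combine-remQuot {ℓ} m p ⟨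
    combine (leaf p) (height p)     ≡⟨ cong₂ combine
      (letter-injective (∷-injectiveˡ eq))
      (toℕ-injective (replicate-injective _ _ (λ ()) (∷-injectiveʳ eq))) ⟩
    combine (leaf q) (height q)     ≡⟨ combine-remQuot {ℓ} m q ⟩
    q                               ∎
    where open ≡-Reasoning

  bound : size broom′ * (2 + s) ≤ 18 * (ℓ * m)
  bound = begin
    size broom′ * (2 + s)       ≡⟨ cong (_* (2 + s)) size≡ ⟩
    (2 + ℓ + m) * (2 + s)  ≤⟨ *-mono-≤ n≤6m σ≤3ℓ ⟩
    6 * m * (3 * ℓ)
      ≡⟨ solve 2 (λ m l → con 6 :* m :* (con 3 :* l) := con 18 :* (l :* m)) refl m ℓ ⟩
    18 * (ℓ * m)           ∎
    where
    open ≤-Reasoning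
    open +-*-Solver

lowerBound : ∀ n σ → 2 ≤ σ → σ ≤ n → LowerBound n σ
lowerBound n σ 2≤σ σ≤n with n ≤? 4
... | yes n≤4 = path-lowerBound n σ 2≤σ σ≤n n≤4
lowerBound n (suc (suc s)) (s≤s (s≤s z≤n)) σ≤n | no n≰4 =
  subst (λ n → LowerBound n (2 + s)) (sym n≡)
    (broom-lowerBound ℓ (suc m) s ℓ≤1+s σ≤3ℓ n≤6m)
  where
  open ≤-Reasoning
  open +-*-Solver
  h = ⌊ s /2⌋
  -- This is the floor of σ/2, so ℓ ≥ 1 and 2ℓ ≤ σ ≤ n.
  ℓ = suc h

  h+h≤s : h + h ≤ s
  h+h≤s = begin
    h + h           ≤⟨ +-monoʳ-≤ h (⌊n/2⌋≤⌈n/2⌉ s) ⟩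
    h + ⌈ s /2⌉     ≡⟨ ⌊n/2⌋+⌈n/2⌉≡n s ⟩
    s               ∎

  ℓ≤1+s : ℓ ≤ suc s
  ℓ≤1+s = s≤s (⌊n/2⌋≤n s)

  σ≤3ℓ : 2 + s ≤ 3 * ℓ
  σ≤3ℓ = begin
    2 + s               ≡⟨ cong (2 +_) (⌊n/2⌋+⌈n/2⌉≡n s) ⟨
    -- `⌈ s /2⌉` is half of s + 1 rounded down, at most half of s + 2 rounded down, which is
    -- `suc h`. Hence σ ≤ 2ℓ + 1.
    2 + (h + ⌈ s /2⌉)   ≤⟨ +-monoʳ-≤ 2 (+-monoʳ-≤ h (⌊n/2⌋-mono (n≤1+n (suc s)))) ⟩
    2 + (h + suc h)     ≤⟨ m≤m+n _ h ⟩
    2 + (h + suc h) + h ≡⟨ solve 1 (λ h → con 2 :+ (h :+ (con 1 :+ h)) :+ h := con 3 :* (con 1 :+ h)) refl h ⟩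
    3 * ℓ               ∎

  2ℓ≤n : ℓ + ℓ ≤ n
  2ℓ≤n = begin
    ℓ + ℓ         ≡⟨ +-suc ℓ h ⟩
    2 + (h + h)   ≤⟨ +-monoʳ-≤ 2 h+h≤s ⟩
    2 + s         ≤⟨ σ≤n ⟩
    n             ∎

  3+ℓ≤n : 3 + ℓ ≤ n
  -- Otherwise 2n ≤ 4 + 2ℓ ≤ 4 + n, so n ≤ 4.
  3+ℓ≤n = ≰⇒> λ n≤2+ℓ → n≰4 (+-cancelʳ-≤ n n 4 (begin
    n + n               ≤⟨ +-mono-≤ n≤2+ℓ n≤2+ℓ ⟩
    (2 + ℓ) + (2 + ℓ)   ≡⟨ solve 1 (λ l → (con 2 :+ l) :+ (con 2 :+ l) := con 4 :+ (l :+ l)) refl ℓ ⟩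
    4 + (ℓ + ℓ)         ≤⟨ +-monoʳ-≤ 4 2ℓ≤n ⟩
    4 + n               ∎))

  -- The broom's path of zeros gets `suc m` edges, hence at least one; with the root edge and ℓ
  -- leaves this makes n nodes.
  m = n ∸ (3 + ℓ)

  n≡ : n ≡ 2 + ℓ + suc m
  n≡ = trans (sym (m+[n∸m]≡n 3+ℓ≤n)) (sym (+-suc (2 + ℓ) m))

  ℓ≤3+m : ℓ ≤ 3 + m
  ℓ≤3+m = +-cancelˡ-≤ ℓ ℓ (3 + m) (begin
    ℓ + ℓ           ≤⟨ 2ℓ≤n ⟩
    n               ≡⟨ n≡ ⟩
    2 + ℓ + suc m   ≡⟨ solve 2 (λ l m → con 2 :+ l :+ (con 1 :+ m) := l :+ (con 3 :+ m)) refl ℓ m ⟩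
    ℓ + (3 + m)     ∎)

  -- From ℓ ≤ 3 + m follows n ≤ 6 + 2m; the constant 6 is what m = 0 requires here.
  n≤6m : 2 + ℓ + suc m ≤ 6 * suc m
  n≤6m = begin
    2 + ℓ + suc m             ≤⟨ +-monoˡ-≤ (suc m) (+-monoʳ-≤ 2 ℓ≤3+m) ⟩
    2 + (3 + m) + suc m       ≤⟨ m≤m+n _ (4 * m) ⟩
    2 + (3 + m) + suc m + 4 * m
      ≡⟨ solve 1 (λ m → con 2 :+ (con 3 :+ m) :+ (con 1 :+ m) :+ con 4 :* m := con 6 :* (con 1 :+ m)) refl m ⟩
    6 * suc m                 ∎

mainTheorem2 : (∃[ C ] ∀ (n σ : ℕ) (T : Tree σ) → Deterministic T → size T ≡ n →
    ∃[ k ] HasCardinality (MinimalAbsentWord T) k × k ≤ C * (n * σ))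
    ×
    (∃[ c ] ∀ (n σ : ℕ) → 2 ≤ σ → σ ≤ n →
    ∃[ T ] Deterministic {σ} T × size T ≡ n ×
    ∃[ k ] HasCardinality (MinimalAbsentWord T) k × n * σ ≤ c * k)
mainTheorem2 = (3 , λ { _ σ T _ refl → mawCount T }) , (18 , lowerBound)
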